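{- Let $b\geq 2$ be an integer such that $b+1$ is not a power of $2$, and let $\alpha$ and $\beta$ be integers with $\alpha\beta\neq 0$. Let $q\geq 5$ be a prime, and let $\mathcal{C}$ be a $b$-primitive covering system consisting of exactly one congruence for each of the moduli $2^j$ with $1\leq j\leq q-1$ and $2^jq$ with $0\leq j\leq q-1$. Let $\mathcal{P}_b(\mathcal{C})$ be an associated set of primitive prime divisors, and let $M=\operatorname{lcm}\left(\{2^{q-1},\,b-1,\,q\}\cup\mathcal{P}_b(\mathcal{C})\right)$. Then there exists an integer $T$ such that for all nonnegative integers $t\equiv T\pmod{M}$ with $tb^t+\alpha>0$ and $(tb^t+\alpha)b+\beta\geq\max \mathcal{P}_b(\mathcal{C})$, we have $\gcd(tb^t+\alpha+\beta,\,b-1)=1$ and $(tb^t+\alpha)b^n+\beta$ is composite for all positive integers $n$.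
   Context: A covering system (of the integers) is a finite collection of congruences $r_i\pmod{m_i}$, $1\le i\le \nu$, such that every integer $n$ satisfies $n\equiv r_i\pmod{m_i}$ for at least one $i$. For integers $b\geq 2$ and $w\geq 1$, a prime $p$ is a primitive prime divisor of $b^w-1$ if $p\mid b^w-1$ and $p\nmid b^\ell-1$ for all $1\leq \ell<w$. A covering system $\mathcal{C}=\{r_i\pmod{m_i}:1\leq i\leq\nu\}$ is called $b$-primitive if there exist distinct primes $p_1,\ldots,p_\nu$ such that, for each $i$, $p_i$ is a primitive prime divisor of $b^{m_i}-1$. For a $b$-primitive covering system $\mathcal{C}$, $\mathcal{P}_b(\mathcal{C})=\{p_1,\ldots,p_\nu\}$ denotes a (fixed, arbitrary) choice of such primes. -}

module Defs where

open import Data.Integer using (ℤ; +_; 0ℤ; ∣_∣) renaming (_-_ to _-ℤ_; _<_ to _<ℤ_)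
import Data.Integer.Divisibility as ℤ
open import Data.List.Base using (List; foldr; map; upTo; _++_)
open import Data.List.Relation.Binary.Permutation.Propositional using (_↭_)
open import Data.List.Relation.Binary.Pointwise using (Pointwise)
open import Data.List.Relation.Unary.Any using (Any)
open import Data.List.Relation.Unary.Unique.Propositional using (Unique)
open import Data.Nat.Base using (ℕ; suc; _*_; _∸_; _^_; _≤_; _<_; NonZero)
open import Data.Nat.Divisibility using (_∣_)
open import Data.Nat.LCM using (lcm)
open import Data.Nat.Primality using (Prime; Composite)
open import Data.Product.Base using (∃; _×_)
open import Relation.Binary.PropositionalEquality using (_≡_)
open import Relation.Nullary.Negation using (¬_)

infix 4 _≡_[mod_]

_≡_[mod_] : ℤ → ℤ → ℕ → Set
x ≡ y [mod m ] = + m ℤ.∣ x -ℤ y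

record Congruence : Set where
  field
    residue : ℤ
    modulus : ℕ
    .{{modulus≢0}} : NonZero modulus

open Congruence public

record CoveringSystem : Set where
  field
    congruences : List Congruence
    covers      : ∀ (n : ℤ) →
                  Any (λ c → n ≡ residue c [mod modulus c ]) congruences

open CoveringSystem public

IsPowerOfTwo : ℕ → Set
IsPowerOfTwo n = ∃ λ k → n ≡ 2 ^ k

-- For b ≥ 1, the truncated difference b ^ w ∸ 1 is the true one.
record PrimitivePrimeDivisor (b w p : ℕ) : Set where
  field
    prime   : Prime p
    divides : p ∣ b ^ w ∸ 1
    minimal : ∀ ℓ → 1 ≤ ℓ → ℓ < w → ¬ (p ∣ b ^ ℓ ∸ 1)

-- A proof of b-primitivity carries a choice of the associated primes; the
-- i-th entry of `primes` belongs to the i-th congruence.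
record IsPrimitive (b : ℕ) (C : CoveringSystem) : Set where
  field
    primes     : List ℕ
    distinct   : Unique primes
    associated : Pointwise (λ c p → PrimitivePrimeDivisor b (modulus c) p)
                           (congruences C) primes

open IsPrimitive public using (primes)

-- 2 ^ j for 1 ≤ j ≤ q - 1, followed by 2 ^ j * q for 0 ≤ j ≤ q - 1.
prescribedModuli : ℕ → List ℕ
prescribedModuli q =
  map (λ i → 2 ^ suc i) (upTo (q ∸ 1)) ++ map (λ j → 2 ^ j * q) (upTo q)

-- For an odd prime q the prescribed moduli are pairwise distinct, so being a
-- permutation of them means that each one occurs exactly once and no other
-- modulus occurs.
HasPrescribedModuli : ℕ → CoveringSystem → Set
HasPrescribedModuli q C = map modulus (congruences C) ↭ prescribedModuli q

lcmOf : List ℕ → ℕ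
lcmOf = foldr lcm 1

CompositeInteger : ℤ → Set
CompositeInteger z = 0ℤ <ℤ z × Composite ∣ z ∣

{-# OPTIONS --safe #-}
module Submission where

-- Let pᵢ be the prime attached to the class rᵢ (mod mᵢ).  Since b has order mᵢ
-- modulo pᵢ, pᵢ divides k bⁿ + β for all n in that class as soon as
-- k ≡ -β b^(-rᵢ) (mod pᵢ).  For k = t bᵗ + α this fixes t modulo pᵢ once t is
-- known modulo mᵢ, and the Chinese remainder theorem provides T.  The order bound
-- mᵢ < pᵢ keeps the pᵢ away from 2, from b - 1, and from q when q ∣ mᵢ.
--
-- A value k bⁿ + β ≥ max P divisible by some p in P is composite unless it equals
-- p, which forces n = 1 and k b + β = max P.  This happens for at most one t, so of
-- the two solutions T coming from t + α + β ≡ 1 and t + α + β ≡ -1 (mod b - 1),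
-- which differ modulo 2^(q-1), at least one avoids it.

open import Data.Fin.Base as Fin using (Fin; toℕ; fromℕ<)
import Data.Fin.Properties as Fin
open import Data.Integer.Base using (ℤ; +_; 0ℤ; 1ℤ; -1ℤ; _+_; _*_; _-_; -_; _^_; _≤_; _<_; _≥_; ∣_∣)
import Data.Integer.Base as ℤ
import Data.Integer.DivMod as ℤ
open import Data.Integer.Divisibility.Signed using (divides; ∣ᵤ⇒∣; ∣⇒∣ᵤ)
import Data.Integer.Divisibility.Signed as ℤ
open import Data.Integer.GCD using (gcd)
import Data.Integer.Properties as ℤ
open import Data.Integer.Tactic.RingSolver using (solve-∀)
open import Data.List.Base using (_∷_)
open import Data.List.Extrema.Nat using (max; xs≤max)
open import Data.List.Membership.Propositional using (_∈_)
open import Data.List.Membership.Propositional.Properties using (∈-upTo⁻)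
open import Data.List.Relation.Binary.Permutation.Propositional using (↭-sym)
open import Data.List.Relation.Binary.Permutation.Propositional.Properties using (All-resp-↭)
open import Data.List.Relation.Binary.Pointwise using (Pointwise; []; _∷_)
open import Data.List.Relation.Unary.All as All using (All; []; _∷_)
import Data.List.Relation.Unary.All.Properties as All
open import Data.List.Relation.Unary.AllPairs using ([]; _∷_)
open import Data.List.Relation.Unary.Any using (Any; here; there)
open import Data.List.Relation.Unary.Unique.Propositional using (Unique)
open import Data.Nat.Base as ℕ using (ℕ; zero; suc; NonZero)
open import Data.Nat.Coprimality using (Coprime; coprime-Bézout; coprime-divisor)
import Data.Nat.Coprimality as Coprime
import Data.Nat.Divisibility as ℕ
open import Data.Nat.GCD using (module Bézout)
import Data.Nat.GCD as ℕ
open import Data.Nat.LCM using (m∣lcm[m,n]; n∣lcm[m,n])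
open import Data.Nat.Primality
  using (Prime; prime⇒nonTrivial; prime⇒nonZero; prime⇒irreducible; euclidsLemma)
import Data.Nat.Properties as ℕ
open import Data.Product.Base using (∃; ∃₂; _×_; _,_)
open import Data.Sum.Base using (_⊎_; inj₁; inj₂; [_,_]′)
open import Function.Base using (_∘_; id; _$_)
open import Relation.Binary.Definitions using (tri<; tri≈; tri>)
open import Relation.Binary.PropositionalEquality
  using (_≡_; _≢_; refl; sym; trans; cong; subst; module ≡-Reasoning)
open import Relation.Nullary.Decidable using (yes; no; _×-dec_)
open import Relation.Nullary.Negation using (¬_; contradiction)
open import Defs

private
  variable
    m n p q b t : ℕ
    x y z u v : ℤ

-- Arithmetic of integer congruences.

infix 4 _≈_⟨_⟩

-- Unlike _≡_[mod_], this form of congruence lets Agda infer x, y and m.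
record _≈_⟨_⟩ (x y : ℤ) (m : ℕ) : Set where
  constructor by
  field
    quotient : ℤ
    equality : x ≡ y + quotient * + m

≈-fromMod : x ≡ y [mod m ] → x ≈ y ⟨ m ⟩
≈-fromMod {x} {y} {m} d with ∣ᵤ⇒∣ {+ m} {x - y} d
... | divides k eq = by k (trans (lemma x y) (cong (_+_ y) eq))
  where
  lemma : ∀ x y → x ≡ y + (x - y)
  lemma = solve-∀

≈⇒∣- : x ≈ y ⟨ m ⟩ → + m ℤ.∣ x - y
≈⇒∣- {y = y} {m} (by k refl) = divides k (lemma y (k * + m))
  where
  lemma : ∀ y z → y + z - y ≡ z
  lemma = solve-∀

≈-refl : x ≈ x ⟨ m ⟩
≈-refl {x} {m} = by 0ℤ (lemma x (+ m))
  where
  lemma : ∀ x m → x ≡ x + 0ℤ * m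
  lemma = solve-∀

≈-reflexive : x ≡ y → x ≈ y ⟨ m ⟩
≈-reflexive refl = ≈-refl

≈-sym : x ≈ y ⟨ m ⟩ → y ≈ x ⟨ m ⟩
≈-sym {y = y} {m} (by k refl) = by (- k) (lemma y k (+ m))
  where
  lemma : ∀ y k m → y ≡ y + k * m + - k * m
  lemma = solve-∀

≈-trans : x ≈ y ⟨ m ⟩ → y ≈ z ⟨ m ⟩ → x ≈ z ⟨ m ⟩
≈-trans {m = m} {z} (by k refl) (by l refl) = by (l + k) (lemma z k l (+ m))
  where
  lemma : ∀ z k l m → z + l * m + k * m ≡ z + (l + k) * m
  lemma = solve-∀

+-cong : x ≈ y ⟨ m ⟩ → u ≈ v ⟨ m ⟩ → x + u ≈ y + v ⟨ m ⟩
+-cong {y = y} {m} {v = v} (by k refl) (by l refl) = by (k + l) (lemma y v k l (+ m))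
  where
  lemma : ∀ y v k l m → y + k * m + (v + l * m) ≡ y + v + (k + l) * m
  lemma = solve-∀

*-cong : x ≈ y ⟨ m ⟩ → u ≈ v ⟨ m ⟩ → x * u ≈ y * v ⟨ m ⟩
*-cong {y = y} {m} {v = v} (by k refl) (by l refl) =
  by (k * v + y * l + k * l * + m) (lemma y v k l (+ m))
  where
  lemma : ∀ y v k l m →
    (y + k * m) * (v + l * m) ≡ y * v + (k * v + y * l + k * l * m) * m
  lemma = solve-∀

^-cong : ∀ e → x ≈ y ⟨ m ⟩ → x ^ e ≈ y ^ e ⟨ m ⟩
^-cong zero    x≈y = ≈-refl
^-cong (suc e) x≈y = *-cong x≈y (^-cong e x≈y)

≈-weaken : m ℕ.∣ n → x ≈ y ⟨ n ⟩ → x ≈ y ⟨ m ⟩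
≈-weaken {m} {y = y} (ℕ.divides d refl) (by k refl) =
  by (k * + d) (cong (_+_ y) (trans (cong (k *_) (ℤ.pos-* d m)) (sym (ℤ.*-assoc k (+ d) (+ m)))))

≈0⇒∣ : + n ≈ 0ℤ ⟨ m ⟩ → m ℕ.∣ n
≈0⇒∣ {n} {m} n≈0 = ∣⇒∣ᵤ {+ m} {+ n} (subst (+ m ℤ.∣_) (ℤ.+-identityʳ (+ n)) (≈⇒∣- n≈0))

∣⇒≈0 : m ℕ.∣ n → + n ≈ 0ℤ ⟨ m ⟩
∣⇒≈0 {m} (ℕ.divides k refl) = by (+ k) (trans (ℤ.pos-* k m) (sym (ℤ.+-identityˡ _)))

%ℕ-≈ : ∀ x m .{{_ : NonZero m}} → + (x ℤ.%ℕ m) ≈ x ⟨ m ⟩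
%ℕ-≈ x m = ≈-sym (by (x ℤ./ℕ m) (ℤ.a≡a%ℕn+[a/ℕn]*n x m))

-- Powers of b modulo p and the order of b.

pos-^ : ∀ b e → + (b ℕ.^ e) ≡ (+ b) ^ e
pos-^ b zero    = refl
pos-^ b (suc e) = trans (ℤ.pos-* b (b ℕ.^ e)) (cong (+ b *_) (pos-^ b e))

pos-∸1 : ∀ n → 1 ℕ.≤ n → + (n ℕ.∸ 1) ≡ + n - 1ℤ
pos-∸1 n 1≤n = sym (trans (ℤ.m-n≡m⊖n n 1) (ℤ.⊖-≥ 1≤n))

1≤^ : ∀ b e → 2 ℕ.≤ b → 1 ℕ.≤ b ℕ.^ e
1≤^ b@(suc _) e _ = ℕ.m^n>0 b e

∣^∸1⇒≈1 : 2 ℕ.≤ b → p ℕ.∣ b ℕ.^ m ℕ.∸ 1 → (+ b) ^ m ≈ 1ℤ ⟨ p ⟩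
∣^∸1⇒≈1 {b} {p} {m} 2≤b p∣ =
  ≈-trans (≈-reflexive (trans (lemma ((+ b) ^ m)) (cong (_+_ 1ℤ) (sym eq))))
          (+-cong (≈-refl {1ℤ}) (∣⇒≈0 p∣))
  where
  lemma : ∀ x → x ≡ 1ℤ + (x - 1ℤ)
  lemma = solve-∀
  eq : + (b ℕ.^ m ℕ.∸ 1) ≡ (+ b) ^ m - 1ℤ
  eq = trans (pos-∸1 _ (1≤^ b m 2≤b)) (cong (_- 1ℤ) (pos-^ b m))

≈1⇒∣^∸1 : 2 ℕ.≤ b → (+ b) ^ m ≈ 1ℤ ⟨ p ⟩ → p ℕ.∣ b ℕ.^ m ℕ.∸ 1
≈1⇒∣^∸1 {b} {m} {p} 2≤b ≈1 =
  ∣⇒∣ᵤ {+ p} {+ (b ℕ.^ m ℕ.∸ 1)} (subst (+ p ℤ.∣_) (sym eq) (≈⇒∣- ≈1))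
  where
  eq : + (b ℕ.^ m ℕ.∸ 1) ≡ (+ b) ^ m - 1ℤ
  eq = trans (pos-∸1 _ (1≤^ b m 2≤b)) (cong (_- 1ℤ) (pos-^ b m))

module _ {B : ℤ} {m p : ℕ} .{{_ : NonZero m}} (B^m≈1 : B ^ m ≈ 1ℤ ⟨ p ⟩) where

  ∣⇒^≈1 : m ℕ.∣ n → B ^ n ≈ 1ℤ ⟨ p ⟩
  ∣⇒^≈1 (ℕ.divides k refl) =
    ≈-trans (≈-reflexive (trans (cong (B ^_) (ℕ.*-comm k m)) (sym (ℤ.^-*-assoc B m k))))
            (≈-trans (^-cong k B^m≈1) (≈-reflexive (ℤ.^-zeroˡ k)))

  -- The exponents add up to n - x modulo m, hence to a multiple of m. Reducing -x modulo m gives a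
  -- natural exponent for the inverse power.
  ^-inverse : + n ≈ x ⟨ m ⟩ → B ^ n * B ^ ((- x) ℤ.%ℕ m) ≈ 1ℤ ⟨ p ⟩
  ^-inverse {n} {x} n≈x =
    ≈-trans (≈-reflexive (sym (ℤ.^-distribˡ-+-* B n _))) $ ∣⇒^≈1 $ ≈0⇒∣ $
    ≈-trans (≈-reflexive (ℤ.pos-+ n _)) $
    ≈-trans (+-cong n≈x (%ℕ-≈ (- x) m)) (≈-reflexive (ℤ.+-inverseʳ x))

-- Pigeonhole: 0 together with the powers B⁰, ..., B^(m-1) gives m + 1 pairwise incongruent residues
-- modulo p. Including 0 makes the inequality strict.
order<prime : 2 ℕ.≤ b → .{{NonZero m}} → PrimitivePrimeDivisor b m p → m ℕ.< p
order<prime {b} {m} {p} 2≤b prim = Fin.injective⇒≤ f-injective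
  where
  open PrimitivePrimeDivisor prim renaming (divides to p∣)
  instance
    p≢0 = prime⇒nonZero prime
  B = + b
  B^m≈1 : B ^ m ≈ 1ℤ ⟨ p ⟩
  B^m≈1 = ∣^∸1⇒≈1 {m = m} 2≤b p∣

  g : Fin (suc m) → ℤ
  g Fin.zero    = 0ℤ
  g (Fin.suc i) = B ^ toℕ i

  f : Fin (suc m) → Fin p
  f i = fromℕ< (ℤ.n%ℕd<d (g i) p)

  1≉0 : ¬ (1ℤ ≈ 0ℤ ⟨ p ⟩)
  1≉0 1≈0 = ℕ.nonTrivial⇒≢1 {{prime⇒nonTrivial prime}} (ℕ.∣1⇒≡1 (≈0⇒∣ {1} 1≈0))

  cofactor : ∀ {i} → i ℕ.≤ m → B ^ i * B ^ (m ℕ.∸ i) ≈ 1ℤ ⟨ p ⟩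
  cofactor {i} i≤m =
    ≈-trans (≈-reflexive (trans (sym (ℤ.^-distribˡ-+-* B i _)) (cong (B ^_) (ℕ.m+[n∸m]≡n i≤m)))) B^m≈1

  ^≉0 : ∀ {i} → i ℕ.≤ m → ¬ (B ^ i ≈ 0ℤ ⟨ p ⟩)
  ^≉0 {i} i≤m ^≈0 = 1≉0 $
    ≈-trans (≈-sym (cofactor i≤m))
      (≈-trans (*-cong ^≈0 (≈-refl {B ^ (m ℕ.∸ i)})) (≈-reflexive (ℤ.*-zeroˡ (B ^ (m ℕ.∸ i)))))

  ^≉^ : ∀ {i j} → i ℕ.< j → j ℕ.< m → ¬ (B ^ i ≈ B ^ j ⟨ p ⟩)
  ^≉^ {i} {j} i<j j<m ^≈^ =
    -- Multiplying Bⁱ ≈ Bʲ by B^(m-i) gives 1 ≈ B^(j-i) Bᵐ ≈ B^(j-i), against minimality because 0 <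
    -- j - i < m.
    minimal (j ℕ.∸ i) (ℕ.m<n⇒0<n∸m i<j) (ℕ.≤-<-trans (ℕ.m∸n≤m j i) j<m) $ ≈1⇒∣^∸1 {m = j ℕ.∸ i} 2≤b $
    ≈-trans (≈-sym (≈-trans (*-cong (≈-refl {B ^ (j ℕ.∸ i)}) B^m≈1) (≈-reflexive (ℤ.*-identityʳ _)))) $
    ≈-trans (≈-reflexive eq) $
    ≈-trans (*-cong (≈-sym ^≈^) (≈-refl {B ^ (m ℕ.∸ i)})) (cofactor i≤m)
    where
    i≤m : i ℕ.≤ m
    i≤m = ℕ.<⇒≤ (ℕ.<-trans i<j j<m)
    eq : B ^ (j ℕ.∸ i) * B ^ m ≡ B ^ j * B ^ (m ℕ.∸ i)
    eq = begin
      B ^ (j ℕ.∸ i) * B ^ m            ≡⟨ ℤ.^-distribˡ-+-* B (j ℕ.∸ i) m ⟨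
      B ^ (j ℕ.∸ i ℕ.+ m)              ≡⟨ cong (λ e → B ^ (j ℕ.∸ i ℕ.+ e)) (ℕ.m+[n∸m]≡n i≤m) ⟨
      B ^ (j ℕ.∸ i ℕ.+ (i ℕ.+ (m ℕ.∸ i))) ≡⟨ cong (B ^_) (ℕ.+-assoc (j ℕ.∸ i) i _) ⟨
      B ^ (j ℕ.∸ i ℕ.+ i ℕ.+ (m ℕ.∸ i)) ≡⟨ cong (λ e → B ^ (e ℕ.+ (m ℕ.∸ i))) (ℕ.m∸n+n≡m (ℕ.<⇒≤ i<j)) ⟩
      B ^ (j ℕ.+ (m ℕ.∸ i))            ≡⟨ ℤ.^-distribˡ-+-* B j _ ⟩
      B ^ j * B ^ (m ℕ.∸ i)            ∎
      where open ≡-Reasoning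

  g-injective : ∀ i j → g i ≈ g j ⟨ p ⟩ → i ≡ j
  g-injective Fin.zero    Fin.zero    _ = refl
  g-injective Fin.zero    (Fin.suc j) e = contradiction (≈-sym e) (^≉0 (ℕ.<⇒≤ (Fin.toℕ<n j)))
  g-injective (Fin.suc i) Fin.zero    e = contradiction e (^≉0 (ℕ.<⇒≤ (Fin.toℕ<n i)))
  g-injective (Fin.suc i) (Fin.suc j) e with ℕ.<-cmp (toℕ i) (toℕ j)
  ... | tri< i<j _ _ = contradiction e (^≉^ i<j (Fin.toℕ<n j))
  ... | tri≈ _ i≡j _ = cong Fin.suc (Fin.toℕ-injective i≡j)
  ... | tri> _ _ j<i = contradiction (≈-sym e) (^≉^ j<i (Fin.toℕ<n i))

  f-injective : ∀ {i j} → f i ≡ f j → i ≡ j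
  f-injective {i} {j} fi≡fj = g-injective i j $
    ≈-trans (≈-sym (%ℕ-≈ (g i) p)) $
    ≈-trans (≈-reflexive (cong +_ (Fin.fromℕ<-injective _ _ _ _ fi≡fj))) (%ℕ-≈ (g j) p)

-- The Chinese remainder theorem and divisibility by primes.

crt : Coprime m n → ∀ x y → ∃ λ z → z ≈ x ⟨ m ⟩ × z ≈ y ⟨ n ⟩
crt {m} {n} m⊥n x y with coprime-Bézout m⊥n
... | Bézout.+- k l eq =
      -- By Bézout, k m is 0 modulo m and 1 modulo n, so it switches x to y modulo n only. In the
      -- other sign case l n plays this part with x and y exchanged.
      x + (y - x) * (+ k * + m)
    , by ((y - x) * + k) (cong (_+_ x) (sym (ℤ.*-assoc (y - x) (+ k) (+ m))))
    , by ((y - x) * + l)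
         (trans (cong (λ e → x + (y - x) * e) (sym eq′)) (lemma x y (+ l) (+ n)))
  where
  eq′ : 1ℤ + + l * + n ≡ + k * + m
  eq′ = begin
    1ℤ + + l * + n      ≡⟨ cong (_+_ 1ℤ) (ℤ.pos-* l n) ⟨
    + (1 ℕ.+ l ℕ.* n)   ≡⟨ cong +_ eq ⟩
    + (k ℕ.* m)         ≡⟨ ℤ.pos-* k m ⟩
    + k * + m           ∎
    where open ≡-Reasoning
  lemma : ∀ x y l n → x + (y - x) * (1ℤ + l * n) ≡ y + (y - x) * l * n
  lemma = solve-∀
... | Bézout.-+ k l eq =
      y + (x - y) * (+ l * + n)
    , by ((x - y) * + k)
         (trans (cong (λ e → y + (x - y) * e) (sym eq′)) (lemma x y (+ k) (+ m)))
    , by ((x - y) * + l) (cong (_+_ y) (sym (ℤ.*-assoc (x - y) (+ l) (+ n))))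
  where
  eq′ : 1ℤ + + k * + m ≡ + l * + n
  eq′ = begin
    1ℤ + + k * + m      ≡⟨ cong (_+_ 1ℤ) (ℤ.pos-* k m) ⟨
    + (1 ℕ.+ k ℕ.* m)   ≡⟨ cong +_ eq ⟩
    + (l ℕ.* n)         ≡⟨ ℤ.pos-* l n ⟩
    + l * + n           ∎
    where open ≡-Reasoning
  lemma : ∀ x y k m → y + (x - y) * (1ℤ + k * m) ≡ x + (x - y) * k * m
  lemma = solve-∀

prime∤⇒coprime : Prime p → ¬ (p ℕ.∣ n) → Coprime n p
prime∤⇒coprime pr p∤n (d∣n , d∣p) with prime⇒irreducible pr d∣p
... | inj₁ d≡1  = d≡1
... | inj₂ refl = contradiction d∣n p∤n

prime∣prime⇒≡ : Prime p → Prime q → p ℕ.∣ q → p ≡ q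
prime∣prime⇒≡ pp pq p∣q with prime⇒irreducible pq p∣q
... | inj₁ p≡1 = contradiction p≡1 (ℕ.nonTrivial⇒≢1 {{prime⇒nonTrivial pp}})
... | inj₂ p≡q = p≡q

prime∣^⇒∣ : ∀ e → Prime p → p ℕ.∣ n ℕ.^ e → p ℕ.∣ n
prime∣^⇒∣ zero pr p∣1 = contradiction (ℕ.∣1⇒≡1 p∣1) (ℕ.nonTrivial⇒≢1 {{prime⇒nonTrivial pr}})
prime∣^⇒∣ {n = n} (suc e) pr p∣ = [ id , prime∣^⇒∣ e pr ]′ (euclidsLemma n (n ℕ.^ e) pr p∣)

coprime-∣ : Coprime m n → m ℕ.∣ t → n ℕ.∣ t → m ℕ.* n ℕ.∣ t
coprime-∣ {m} {n} m⊥n (ℕ.divides k refl) n∣t =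
  subst (m ℕ.* n ℕ.∣_) (ℕ.*-comm m k)
    (ℕ.*-monoʳ-∣ m (coprime-divisor (Coprime.sym m⊥n) (subst (n ℕ.∣_) (ℕ.*-comm k m) n∣t)))

-- Simultaneous congruences modulo distinct primes.

module _ {A : Set} {R : A → ℕ → Set} (target : A → ℤ) where

  -- A prime dividing N is exempt, since z is already fixed modulo N. Keeping `R a p` lets the
  -- outcome of one pass serve as the relation `R` of a second pass.
  Hits : ℕ → ℤ → A → ℕ → Set
  Hits N z a p = R a p × (p ℕ.∣ N ⊎ z ≈ target a ⟨ p ⟩)

  -- Induction on the primes: after z is adjusted modulo p, the preserved modulus grows from N to N
  -- p, so later adjustments keep the residue modulo p.
  simultaneous : ∀ {as ps} → Pointwise R as ps → All Prime ps → Unique ps →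
                 ∀ N x → ∃ λ z → z ≈ x ⟨ N ⟩ × Pointwise (Hits N z) as ps
  simultaneous [] [] [] N x = x , ≈-refl , []
  simultaneous {a ∷ as} {p ∷ ps} (r ∷ rs) (pp ∷ pps) (p∉ps ∷ uniq) N x with p ℕ.∣? N
  ... | yes p∣N with z , z≈x , hits ← simultaneous rs pps uniq N x =
        z , z≈x , (r , inj₁ p∣N) ∷ hits
  ... | no p∤N
      with y , y≈x , y≈a ← crt (prime∤⇒coprime pp p∤N) x (target a)
      with z , z≈y , hits ← simultaneous rs pps uniq (N ℕ.* p) y =
        z , ≈-trans (≈-weaken (ℕ.m∣m*n p) z≈y) y≈x ,
        (r , inj₂ (≈-trans (≈-weaken (ℕ.n∣m*n N) z≈y) y≈a)) ∷ restrict hits pps p∉ps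
    where
    restrict : ∀ {as ps z} → Pointwise (Hits (N ℕ.* p) z) as ps → All Prime ps → All (p ≢_) ps →
               Pointwise (Hits N z) as ps
    restrict [] [] [] = []
    restrict ((r , inj₂ z≈) ∷ hs) (_ ∷ pps) (_ ∷ ≢s) = (r , inj₂ z≈) ∷ restrict hs pps ≢s
    -- An exemption relative to N p is one relative to N, because p′ differs from p.
    restrict ((r , inj₁ p′∣) ∷ hs) (pp′ ∷ pps) (p≢p′ ∷ ≢s) with euclidsLemma N p pp′ p′∣
    ... | inj₁ p′∣N = (r , inj₁ p′∣N) ∷ restrict hs pps ≢s
    ... | inj₂ p′∣p = contradiction (sym (prime∣prime⇒≡ pp′ pp p′∣p)) p≢p′

-- Aligned lists and the shape of the prescribed moduli.

Pointwise-zipAny : ∀ {A B : Set} {P : A → Set} {R : A → B → Set} {as bs} →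
                   Any P as → Pointwise R as bs → ∃₂ λ a b → b ∈ bs × P a × R a b
Pointwise-zipAny (here pa)  (r ∷ _)  = _ , _ , here refl , pa , r
Pointwise-zipAny (there any) (_ ∷ rs) with a , b , b∈ , pa , r ← Pointwise-zipAny any rs =
  a , b , there b∈ , pa , r

Pointwise-zipAll : ∀ {A B : Set} {P : A → Set} {R : A → B → Set} {as bs} →
                   All P as → Pointwise R as bs → Pointwise (λ a b → P a × R a b) as bs
Pointwise-zipAll []         []       = []
Pointwise-zipAll (pa ∷ pas) (r ∷ rs) = (pa , r) ∷ Pointwise-zipAll pas rs

∣lcmOf : ∀ {n ns} → n ∈ ns → n ℕ.∣ lcmOf ns
∣lcmOf {ns = m ∷ ns} (here refl)  = m∣lcm[m,n] m (lcmOf ns)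
∣lcmOf {ns = m ∷ ns} (there n∈ns) = ℕ.∣-trans (∣lcmOf n∈ns) (n∣lcm[m,n] m (lcmOf ns))

-- The alternative separates moduli for which t modulo a power of 2 suffices from those which, being
-- at least q, force the attached prime above q.
Admissible : ℕ → ℕ → Set
Admissible q m = 2 ℕ.≤ m × (m ℕ.∣ 2 ℕ.^ (q ℕ.∸ 1) ⊎ (q ℕ.≤ m × m ℕ.∣ 2 ℕ.^ (q ℕ.∸ 1) ℕ.* q))

2^-mono-∣ : m ℕ.≤ n → 2 ℕ.^ m ℕ.∣ 2 ℕ.^ n
2^-mono-∣ {m} {n} m≤n = ℕ.divides (2 ℕ.^ (n ℕ.∸ m)) $
  trans (cong (2 ℕ.^_) (sym (ℕ.m∸n+n≡m m≤n))) (ℕ.^-distribˡ-+-* 2 (n ℕ.∸ m) m)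

prescribedModuli-admissible : 2 ℕ.≤ q → All (Admissible q) (prescribedModuli q)
prescribedModuli-admissible {q@(suc q-1)} 2≤q = All.++⁺
  (All.map⁺ (All.tabulate λ i∈ → powers (∈-upTo⁻ i∈)))
  (All.map⁺ (All.tabulate λ j∈ → multiples (∈-upTo⁻ j∈)))
  where
  powers : ∀ {i} → i ℕ.< q-1 → Admissible q (2 ℕ.^ suc i)
  powers {i} i<q-1 = ℕ.*-monoʳ-≤ 2 (ℕ.m^n>0 2 i) , inj₁ (2^-mono-∣ i<q-1)

  multiples : ∀ {j} → j ℕ.< q → Admissible q (2 ℕ.^ j ℕ.* q)
  multiples {j} (ℕ.s≤s j≤q-1) =
    ℕ.≤-trans 2≤q q≤ , inj₂ (q≤ , ℕ.*-monoˡ-∣ q (2^-mono-∣ j≤q-1))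
    where
    q≤ : q ℕ.≤ 2 ℕ.^ j ℕ.* q
    q≤ = ℕ.m≤n*m q (2 ℕ.^ j) {{ℕ.m^n≢0 2 j}}

-- Criteria for gcd 1 and for compositeness.

≈unit⇒gcd≡1 : ∀ x u y → ∣ u ∣ ≡ 1 → x ≈ u ⟨ ∣ y ∣ ⟩ → gcd x y ≡ 1ℤ
≈unit⇒gcd≡1 x u y ∣u∣≡1 x≈u = cong +_ (ℕ.∣1⇒≡1 (subst (d ℕ.∣_) ∣u∣≡1 (∣⇒∣ᵤ {+ d} {u} d∣u)))
  where
  d = ℕ.gcd ∣ x ∣ ∣ y ∣
  x≈0 : x ≈ 0ℤ ⟨ d ⟩
  x≈0 = ≈-fromMod (subst (λ z → d ℕ.∣ ∣ z ∣) (sym (ℤ.+-identityʳ x)) (ℕ.gcd[m,n]∣m ∣ x ∣ ∣ y ∣))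
  d∣u : + d ℤ.∣ u
  d∣u = subst (+ d ℤ.∣_) (ℤ.+-identityʳ u) $ ≈⇒∣- $
    ≈-trans (≈-sym (≈-weaken (ℕ.gcd[m,n]∣n ∣ x ∣ ∣ y ∣) x≈u)) x≈0

prime-divisor⇒composite : Prime p → x ≈ 0ℤ ⟨ p ⟩ → + p < x → CompositeInteger x
prime-divisor⇒composite {p} {+ n} p-prime n≈0 (ℤ.+<+ p<n) =
  ℤ.+<+ (ℕ.≤-<-trans ℕ.z≤n p<n) , ℕ.hasNonTrivialDivisor {{prime⇒nonTrivial p-prime}} p<n (≈0⇒∣ n≈0)

-- For positive k the value at n = 1 is the least one, so a lower bound for k b + β carries over to
-- every n ≥ 1.
*-≤-*^ : 2 ℕ.≤ b → 0ℤ < x → 1 ℕ.≤ n → x * + b ≤ x * (+ b) ^ n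
*-≤-*^ {b} {+ i} {suc n} 2≤b _ _ = ℤ.*-monoˡ-≤-nonNeg (+ i) $
  subst (+ b ≤_) (pos-^ b (suc n)) (ℤ.+≤+ (ℕ.m≤m*n b (b ℕ.^ n) {{ℕ.>-nonZero (1≤^ b n 2≤b)}}))

-- Choosing T so that each value has a divisor in P.

module _ (b : ℕ) (2≤b : 2 ℕ.≤ b) (α β : ℤ) where

  private
    B = + b

    b≢0 : NonZero b
    b≢0 = ℕ.>-nonZero (ℕ.<⇒≤ 2≤b)

  k : ℕ → ℤ
  k t = + t * B ^ t + α

  -- With t ≡ x (mod m), this is the residue of t modulo p that makes
  -- t bᵗ + α ≡ -β b⁻ʳ, the exponents -r and -x being reduced modulo m.
  target : ℤ → Congruence → ℤ
  target x c = (- α - β * B ^ ((- residue c) ℤ.%ℕ modulus c)) * B ^ ((- x) ℤ.%ℕ modulus c)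

  target-divides : ∀ {c x p t n} → B ^ modulus c ≈ 1ℤ ⟨ p ⟩ →
                   + t ≈ x ⟨ modulus c ⟩ → + t ≈ target x c ⟨ p ⟩ →
                   + n ≈ residue c ⟨ modulus c ⟩ → k t * B ^ n + β ≈ 0ℤ ⟨ p ⟩
  target-divides {c} {x} {p} {t} {n} B^m≈1 t≈x t≈target n≈r =
    ≈-trans (+-cong (*-cong (+-cong (*-cong t≈target (≈-refl {B ^ t})) (≈-refl {α})) (≈-refl {B ^ n})) (≈-refl {β})) $
    -- The factor V cancels against Bᵗ, as t ≡ x, and afterwards U against Bⁿ, as n ≡ r; what
    -- remains is β - β.
    ≈-trans (≈-reflexive (rearrange α β U V (B ^ t) (B ^ n))) $
    ≈-trans (+-cong (+-cong (*-cong (≈-refl { (- α - β * U) * B ^ n}) (^-inverse B^m≈1 t≈x))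
                            (≈-refl {α * B ^ n}))
                    (≈-refl {β})) $
    ≈-trans (≈-reflexive (simplify α β U (B ^ n))) $
    ≈-trans (+-cong (≈-refl {β}) (*-cong (≈-refl { - β}) (^-inverse B^m≈1 n≈r))) $
    ≈-reflexive (cancel β)
    where
    U = B ^ ((- residue c) ℤ.%ℕ modulus c)
    V = B ^ ((- x) ℤ.%ℕ modulus c)
    rearrange : ∀ α β U V X Y →
      ((- α - β * U) * V * X + α) * Y + β ≡ (- α - β * U) * Y * (X * V) + α * Y + β
    rearrange = solve-∀
    simplify : ∀ α β U Y → (- α - β * U) * Y * 1ℤ + α * Y + β ≡ β + - β * (Y * U)
    simplify = solve-∀
    cancel : ∀ β → β + - β * 1ℤ ≡ 0ℤ
    cancel = solve-∀

  module _ (q : ℕ) (q-prime : Prime q) (5≤q : 5 ℕ.≤ q)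
           (C : CoveringSystem) (moduli : HasPrescribedModuli q C) (prim : IsPrimitive b C) where

    private
      P = primes prim
      E = 2 ℕ.^ (q ℕ.∸ 1)
      -- T is prescribed modulo N in advance: the factor b - 1 controls the gcd, and the factor E
      -- fixes t modulo the moduli that are powers of 2.
      N = E ℕ.* (b ℕ.∸ 1)
      M = lcmOf (E ∷ b ℕ.∸ 1 ∷ q ∷ P)

    Associated : Congruence → ℕ → Set
    Associated c p = Admissible q (modulus c) × PrimitivePrimeDivisor b (modulus c) p

    associates : Pointwise Associated (congruences C) P
    associates = Pointwise-zipAll
      (All.map⁻ (All-resp-↭ (↭-sym moduli)
        (prescribedModuli-admissible (ℕ.≤-trans (ℕ.m≤m+n 2 3) 5≤q))))
      (IsPrimitive.associated prim)

    P-prime : All Prime P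
    P-prime = go (IsPrimitive.associated prim)
      where
      go : ∀ {cs ps} → Pointwise (λ c p → PrimitivePrimeDivisor b (modulus c) p) cs ps → All Prime ps
      go []       = []
      go (d ∷ ds) = PrimitivePrimeDivisor.prime d ∷ go ds

    -- A prime dividing E is at most 2, whereas 2 ≤ m < p; a prime dividing b - 1 violates
    -- minimality at exponent 1. Hence no prime of P is exempt because of N.
    associated-∤N : ∀ {c p} → Associated c p → ¬ (p ℕ.∣ N)
    associated-∤N {c} {p} ((2≤m , _) , d) p∣N with euclidsLemma E (b ℕ.∸ 1) prime p∣N
      where open PrimitivePrimeDivisor d
    ... | inj₁ p∣E = ℕ.<⇒≱ (ℕ.≤-<-trans 2≤m (order<prime 2≤b d))
                       (ℕ.∣⇒≤ (prime∣^⇒∣ (q ℕ.∸ 1) (PrimitivePrimeDivisor.prime d) p∣E))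
    ... | inj₂ p∣b-1 = PrimitivePrimeDivisor.minimal d 1 ℕ.≤-refl 2≤m
                         (subst (λ e → p ℕ.∣ e ℕ.∸ 1) (sym (ℕ.^-identityʳ b)) p∣b-1)

    E⊥q : Coprime E q
    E⊥q = prime∤⇒coprime q-prime λ q∣E →
      ℕ.<⇒≱ (ℕ.≤-trans (ℕ.m≤m+n 3 2) 5≤q) (ℕ.∣⇒≤ (prime∣^⇒∣ (q ℕ.∸ 1) q-prime q∣E))

    ∈P⇒∣M : p ∈ P → p ℕ.∣ M
    ∈P⇒∣M p∈P = ∣lcmOf {ns = E ∷ b ℕ.∸ 1 ∷ q ∷ P} (there (there (there p∈P)))

    -- Every modulus divides `E * q`, so t ≡ T (mod M) determines t modulo each of them. As M is
    -- only an lcm, the product divides it by coprimality.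
    E*q∣M : E ℕ.* q ℕ.∣ M
    E*q∣M = coprime-∣ E⊥q (∣lcmOf {ns = E ∷ b ℕ.∸ 1 ∷ q ∷ P} (here refl))
                          (∣lcmOf {ns = E ∷ b ℕ.∸ 1 ∷ q ∷ P} (there (there (here refl))))

    b-1∣M : b ℕ.∸ 1 ℕ.∣ M
    b-1∣M = ∣lcmOf {ns = E ∷ b ℕ.∸ 1 ∷ q ∷ P} (there (here refl))

    admissible-∣ : Admissible q m → m ℕ.∣ E ℕ.* q
    admissible-∣ (_ , inj₁ m∣E)        = ℕ.∣-trans m∣E (ℕ.m∣m*n q)
    admissible-∣ (_ , inj₂ (_ , m∣Eq)) = m∣Eq

    Sieved : ℤ → Set
    Sieved T = ∀ t → + t ≈ T ⟨ M ⟩ → ∀ n → ∃ λ p → Prime p × p ∈ P × k t * B ^ n + β ≈ 0ℤ ⟨ p ⟩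

    -- A residue of T modulo p depends on T modulo m, hence possibly on T
    -- modulo q.  If q itself is one of the primes, its modulus is less than q
    -- and so a power of 2: the first solution x fixes T modulo q, and the
    -- second one leaves that residue alone.
    sieve : ∀ τ → ∃ λ T → T ≈ τ ⟨ N ⟩ × Sieved T
    sieve τ
      with x , x≈τ , hitsˣ ← simultaneous (target τ) associates P-prime (IsPrimitive.distinct prim) N τ
      with T , T≈x , hits ← simultaneous (target x) hitsˣ P-prime (IsPrimitive.distinct prim) (N ℕ.* q) x
      = T , ≈-trans (≈-weaken (ℕ.m∣m*n q) T≈x) x≈τ , divisor
      where
      Eq∣Nq : E ℕ.* q ℕ.∣ N ℕ.* q
      Eq∣Nq = ℕ.*-monoˡ-∣ q (ℕ.m∣m*n {E} (b ℕ.∸ 1))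

      divisor : Sieved T
      divisor t t≈T n
        with c , p , p∈P , n≡r , ((adm , d) , hitˣ) , hit ← Pointwise-zipAny (covers C (+ n)) hits
        = p , prime , p∈P , divides-value adm hitˣ hit
        where
        open PrimitivePrimeDivisor d renaming (divides to p∣b^m-1)

        B^m≈1 : B ^ modulus c ≈ 1ℤ ⟨ p ⟩
        B^m≈1 = ∣^∸1⇒≈1 {m = modulus c} 2≤b p∣b^m-1

        n≈r : + n ≈ residue c ⟨ modulus c ⟩
        n≈r = ≈-fromMod n≡r

        t≈T[p] : + t ≈ T ⟨ p ⟩
        t≈T[p] = ≈-weaken (∈P⇒∣M p∈P) t≈T

        t≈x[Eq] : + t ≈ x ⟨ E ℕ.* q ⟩
        t≈x[Eq] = ≈-trans (≈-weaken E*q∣M t≈T) (≈-weaken Eq∣Nq T≈x)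

        divides-value : Admissible q (modulus c) →
                        p ℕ.∣ N ⊎ x ≈ target τ c ⟨ p ⟩ →
                        p ℕ.∣ N ℕ.* q ⊎ T ≈ target x c ⟨ p ⟩ →
                        k t * B ^ n + β ≈ 0ℤ ⟨ p ⟩
        -- Here the second pass set T modulo p, using x modulo m; t agrees with x modulo `E * q`,
        -- hence modulo m.
        divides-value _ _ (inj₂ T≈target) =
          target-divides {c} {x} {p} {t} {n} B^m≈1 (≈-weaken (admissible-∣ adm) t≈x[Eq])
            (≈-trans t≈T[p] T≈target) n≈r
        divides-value _ (inj₁ p∣N) (inj₁ _) = contradiction p∣N (associated-∤N {c} (adm , d))
        divides-value adm′ (inj₂ x≈target) (inj₁ p∣Nq) with euclidsLemma N q prime p∣Nq
        ... | inj₁ p∣N = contradiction p∣N (associated-∤N {c} (adm , d))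
        ... | inj₂ p∣q with adm′
        ... | _ , inj₂ (q≤m , _) =
          contradiction (ℕ.∣⇒≤ {{prime⇒nonZero q-prime}} p∣q)
                        (ℕ.<⇒≱ (ℕ.≤-<-trans q≤m (order<prime 2≤b d)))
        -- Here p divides q, so t ≡ x (mod p) and the hit of the first pass still applies; its
        -- reference point τ agrees with t modulo m because m divides E.
        ... | _ , inj₁ m∣E =
          target-divides {c} {τ} {p} {t} {n} B^m≈1
            (≈-trans (≈-weaken (ℕ.∣-trans m∣E (ℕ.m∣m*n q)) t≈x[Eq])
                     (≈-weaken (ℕ.∣-trans m∣E (ℕ.m∣m*n {E} (b ℕ.∸ 1))) x≈τ))
            (≈-trans (≈-weaken (ℕ.∣-trans p∣q (ℕ.n∣m*n E {q})) t≈x[Eq]) x≈target) n≈r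

    -- The borderline case k b + β = max P.

    TakesMax : ℕ → Set
    TakesMax t = k t * B + β ≡ + max 0 P

    AvoidsMax : ℤ → Set
    AvoidsMax T = ∀ t → + t ≡ T [mod M ] → ¬ TakesMax t

    -- Isolating t in a natural number equation makes the strict growth of t bᵗ available, which
    -- yields uniqueness, and also gives an explicit bound on t.
    takesMax⇒≡ : ∀ t → TakesMax t → + (t ℕ.* b ℕ.^ t ℕ.* b) ≡ + max 0 P - β - α * B
    takesMax⇒≡ t eq = begin
      + (t ℕ.* b ℕ.^ t ℕ.* b)        ≡⟨ ℤ.pos-* (t ℕ.* b ℕ.^ t) b ⟩
      + (t ℕ.* b ℕ.^ t) * B          ≡⟨ cong (_* B) (ℤ.pos-* t (b ℕ.^ t)) ⟩
      + t * + (b ℕ.^ t) * B          ≡⟨ cong (λ x → + t * x * B) (pos-^ b t) ⟩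
      + t * B ^ t * B                ≡⟨ lemma (+ t * B ^ t) α β B ⟩
      k t * B + β - β - α * B        ≡⟨ cong (λ x → x - β - α * B) eq ⟩
      + max 0 P - β - α * B          ∎
      where
      open ≡-Reasoning
      lemma : ∀ X α β B → X * B ≡ (X + α) * B + β - β - α * B
      lemma = solve-∀

    value-< : ∀ {s t} → s ℕ.< t → s ℕ.* b ℕ.^ s ℕ.< t ℕ.* b ℕ.^ t
    value-< {s} {t} s<t = ℕ.≤-<-trans (ℕ.*-monoʳ-≤ s (ℕ.^-monoʳ-≤ b {{b≢0}} (ℕ.<⇒≤ s<t)))
                                      (ℕ.*-monoˡ-< (b ℕ.^ t) {{ℕ.m^n≢0 b t {{b≢0}}}} s<t)

    takesMax⇒value-≡ : ∀ s t → TakesMax s → TakesMax t → s ℕ.* b ℕ.^ s ≡ t ℕ.* b ℕ.^ t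
    takesMax⇒value-≡ s t max-s max-t = ℕ.*-cancelʳ-≡ (s ℕ.* b ℕ.^ s) (t ℕ.* b ℕ.^ t) b {{b≢0}}
      (ℤ.+-injective (trans (takesMax⇒≡ s max-s) (sym (takesMax⇒≡ t max-t))))

    takesMax-unique : ∀ s t → TakesMax s → TakesMax t → s ≡ t
    takesMax-unique s t max-s max-t with ℕ.<-cmp s t
    ... | tri< s<t _ _ = contradiction (takesMax⇒value-≡ s t max-s max-t) (ℕ.<⇒≢ (value-< s<t))
    ... | tri≈ _ s≡t _ = s≡t
    ... | tri> _ _ t<s = contradiction (takesMax⇒value-≡ t s max-t max-s) (ℕ.<⇒≢ (value-< t<s))

    takesMax⇒≤ : ∀ t → TakesMax t → t ℕ.≤ ∣ + max 0 P - β - α * B ∣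
    takesMax⇒≤ t max-t = ℕ.≤-trans (ℕ.m≤m*n t (b ℕ.^ t) {{ℕ.m^n≢0 b t {{b≢0}}}})
      (ℕ.≤-trans (ℕ.m≤m*n (t ℕ.* b ℕ.^ t) b {{b≢0}}) (ℕ.≤-reflexive (cong ∣_∣ (takesMax⇒≡ t max-t))))

    -- A bounded search decides whether some s ≡ T takes the maximum. If so, any t ≡ T′ that does
    -- equals s by uniqueness, which would make T and T′ congruent.
    avoidsMax-either : ∀ {T T′} → ¬ (T ≈ T′ ⟨ M ⟩) → AvoidsMax T ⊎ AvoidsMax T′
    avoidsMax-either {T} {T′} T≉T′
      with ℕ.anyUpTo? (λ t → (M ℕ.∣? ∣ + t - T ∣) ×-dec (k t * B + β ℤ.≟ + max 0 P))
                      (suc ∣ + max 0 P - β - α * B ∣)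
    ... | no none = inj₁ λ t t≡T max-t → none (t , ℕ.s≤s (takesMax⇒≤ t max-t) , t≡T , max-t)
    ... | yes (s , _ , s≡T , max-s) = inj₂ λ t t≡T′ max-t → T≉T′ $
      ≈-trans (≈-sym (≈-fromMod s≡T))
              (subst (λ r → + r ≈ T′ ⟨ M ⟩) (takesMax-unique t s max-t max-s) (≈-fromMod t≡T′))

    -- The gcd condition and compositeness of all values.

    sieved⇒composite : ∀ u T → ∣ u ∣ ≡ 1 → T ≈ u - α - β ⟨ N ⟩ → Sieved T → AvoidsMax T →
      ∀ t → + t ≡ T [mod M ] → 0ℤ < k t → k t * B + β ≥ + max 0 P →
      gcd (k t + β) (B - 1ℤ) ≡ 1ℤ × (∀ n → 1 ℕ.≤ n → CompositeInteger (k t * B ^ n + β))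
    sieved⇒composite u T ∣u∣≡1 T≈ divisor avoids t t≡T k>0 ≥max =
      ≈unit⇒gcd≡1 (k t + β) u (B - 1ℤ) ∣u∣≡1 k+β≈u , compositeAt
      where
      t≈T : + t ≈ T ⟨ M ⟩
      t≈T = ≈-fromMod t≡T

      B≈1 : B ≈ 1ℤ ⟨ b ℕ.∸ 1 ⟩
      B≈1 = by 1ℤ (trans (lemma B) (cong (λ x → 1ℤ + 1ℤ * x) (sym (pos-∸1 b (ℕ.<⇒≤ 2≤b)))))
        where
        lemma : ∀ x → x ≡ 1ℤ + 1ℤ * (x - 1ℤ)
        lemma = solve-∀

      k+β≈u : k t + β ≈ u ⟨ ∣ B - 1ℤ ∣ ⟩
      k+β≈u = subst (λ x → k t + β ≈ u ⟨ ∣ x ∣ ⟩) (pos-∸1 b (ℕ.<⇒≤ 2≤b)) $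
        -- Modulo b - 1 the power bᵗ is 1, so k + β ≡ t + α + β, and the residue of T was chosen to
        -- make this u.
        ≈-trans (+-cong (+-cong (*-cong
          (≈-trans (≈-weaken b-1∣M t≈T) (≈-weaken (ℕ.n∣m*n E) T≈))
          (≈-trans (^-cong t B≈1) (≈-reflexive (ℤ.^-zeroˡ t)))) (≈-refl {α})) (≈-refl {β})) $
        ≈-reflexive (lemma u α β)
        where
        lemma : ∀ u α β → (u - α - β) * 1ℤ + α + β ≡ u
        lemma = solve-∀

      compositeAt : ∀ n → 1 ℕ.≤ n → CompositeInteger (k t * B ^ n + β)
      compositeAt n 1≤n with p , p-prime , p∈P , p∣ ← divisor t t≈T n =
        prime-divisor⇒composite p-prime p∣ $ begin-strict
          + p                 ≤⟨ ℤ.+≤+ (All.lookup (xs≤max 0 P) p∈P) ⟩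
          -- Avoiding the borderline case makes the chain strict, so p is a proper divisor. The
          -- default 0 cannot exceed any member of P.
          + max 0 P           <⟨ ℤ.≤∧≢⇒< ≥max (avoids t t≡T ∘ sym) ⟩
          k t * B + β         ≤⟨ ℤ.+-monoˡ-≤ β (*-≤-*^ 2≤b k>0 1≤n) ⟩
          k t * B ^ n + β     ∎
        where open ℤ.≤-Reasoning

theorem3p1 : ∀ (b : ℕ) → 2 ℕ.≤ b → ¬ IsPowerOfTwo (b ℕ.+ 1) →
    ∀ (α β : ℤ) → α * β ≢ 0ℤ →
    ∀ (q : ℕ) → Prime q → 5 ℕ.≤ q →
    ∀ (C : CoveringSystem) → HasPrescribedModuli q C →
    ∀ (prim : IsPrimitive b C) →
    let P = primes prim
        M = lcmOf (2 ℕ.^ (q ℕ.∸ 1) ∷ b ℕ.∸ 1 ∷ q ∷ P)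
        B = + b
        k = λ (t : ℕ) → + t * B ^ t + α
    in
    ∃ λ (T : ℤ) →
    ∀ (t : ℕ) → + t ≡ T [mod M ] →
    0ℤ < k t →
    k t * B + β ≥ + max 0 P →
    gcd (k t + β) (B - 1ℤ) ≡ 1ℤ ×
    (∀ (n : ℕ) → 1 ℕ.≤ n → CompositeInteger (k t * B ^ n + β))
theorem3p1 b 2≤b _ α β _ q q-prime 5≤q C moduli prim
  with T , T≈ , divisor ← sieve b 2≤b α β q q-prime 5≤q C moduli prim (1ℤ - α - β)
  with T′ , T′≈ , divisor′ ← sieve b 2≤b α β q q-prime 5≤q C moduli prim (-1ℤ - α - β)
  = [ (λ avoids → T , sieved⇒composite b 2≤b α β q q-prime 5≤q C moduli prim 1ℤ T refl T≈ divisor avoids)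
    , (λ avoids → T′ , sieved⇒composite b 2≤b α β q q-prime 5≤q C moduli prim -1ℤ T′ refl T′≈ divisor′ avoids)
    ]′ (avoidsMax-either b 2≤b α β q q-prime 5≤q C moduli prim T≉T′)
  where
  T≉T′ : ¬ (T ≈ T′ ⟨ lcmOf (2 ℕ.^ (q ℕ.∸ 1) ∷ b ℕ.∸ 1 ∷ q ∷ primes prim) ⟩)
  -- Both residues are known modulo E, and they differ by 1 - (-1) = 2; congruence modulo M would
  -- give E ∣ 2, but E ≥ 4.
  T≉T′ T≈T′ = ℕ.<⇒≱ 2<E $ ℕ.∣⇒≤ $ ≈0⇒∣ {2} $
    ≈-trans (≈-reflexive (lemma α β)) $
    ≈-trans (+-cong (≈-trans (≈-sym (≈-weaken E∣N T≈)) (≈-trans (≈-weaken E∣M′ T≈T′) (≈-weaken E∣N T′≈)))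
                    (≈-refl {1ℤ + α + β})) $
    ≈-reflexive (lemma′ α β)
    where
    E = 2 ℕ.^ (q ℕ.∸ 1)
    E∣N : E ℕ.∣ E ℕ.* (b ℕ.∸ 1)
    E∣N = ℕ.m∣m*n (b ℕ.∸ 1)
    E∣M′ : E ℕ.∣ lcmOf (E ∷ b ℕ.∸ 1 ∷ q ∷ primes prim)
    E∣M′ = m∣lcm[m,n] E (lcmOf (b ℕ.∸ 1 ∷ q ∷ primes prim))
    2<E : 2 ℕ.< E
    2<E = ℕ.<-≤-trans (ℕ.m<m+n 2 {2} ℕ.z<s) (ℕ.^-monoʳ-≤ 2 (ℕ.≤-trans (ℕ.m≤m+n 2 2) (ℕ.∸-monoˡ-≤ 1 5≤q)))
    lemma : ∀ α β → + 2 ≡ (1ℤ - α - β) + (1ℤ + α + β)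
    lemma = solve-∀
    lemma′ : ∀ α β → (-1ℤ - α - β) + (1ℤ + α + β) ≡ 0ℤ
    lemma′ = solve-∀
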